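{- Let $m\ge2$, let $H_k(x):=\sum_{j=k}^{m-1}G_j(x)$ for $k=0,1,\dots,m-1$, and let $\Phi_x(u):=u+\frac{x}{1-u}$ for formal power series $u$ in $x$ with zero constant term. Then for each $k=0,1,\dots,m-2$, $$H_k(x)=\Phi_x\bigl(H_{k+1}(x)\bigr).$$ In particular, writing $U(x):=H_{m-1}(x)=G_{m-1}(x)$, $$G(x)=\Phi_x^{\,m-1}\bigl(U(x)\bigr),$$ where $\Phi_x^{\,m-1}$ denotes the $(m-1)$-fold iterate.
   Context: For an integer $m\ge2$ let $V_m=\{v_0<v_1<\cdots<v_{m-1}\}$ ($v_0=0$, $v_{m-1}=1$) be an $m$-element chain with Gödel implication $v_p\Rightarrow_G v_q=v_{m-1}$ if $p\le q$ and $v_p\Rightarrow_G v_q=v_q$ if $p>q$. For $n\ge1$, consider the $C_{n-1}$ full bracketings of $p_1\Rightarrow_G\cdots\Rightarrow_G p_n$ in $n$ distinct variables (full binary trees with $n$ ordered leaves), $C_k$ being the Catalan numbers. Let $g_n^{(j)}$ be the number of pairs (bracketing, valuation $\{p_1,\dots,p_n\}\to V_m$) for which the bracketed formula evaluates to $v_j$, and $g_n=\sum_{j=0}^{m-1}g_n^{(j)}=m^nC_{n-1}$. Put $G_j(x)=\sum_{n\ge1}g_n^{(j)}x^n$ and $G(x)=\sum_{n\ge1}g_nx^n=\sum_{j=0}^{m-1}G_j(x)$ (formal power series). -}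

module Defs where

import Algebra.Properties.Semiring.Sum as SemiringSum
import Algebra.Properties.CommutativeMonoid.Sum as MonoidSum
open import Data.Bool.Base using (if_then_else_)
open import Data.Fin.Base using (Fin; zero; suc; toℕ; fromℕ)
open import Data.Fin.Properties as Fin using (_≤?_)
open import Data.Integer.Base as ℤ using (ℤ; +_)
import Data.Integer.Properties as ℤ
open import Data.List.Base
  using (List; []; _∷_; [_]; length; map; filter; concatMap; cartesianProductWith; upTo; allFin)
open import Data.List.Membership.Propositional using (_∈_; find; lose)
open import Data.List.Membership.Propositional.Properties
  using (∈-concatMap⁺; ∈-concatMap⁻; ∈-cartesianProductWith⁺; ∈-cartesianProductWith⁻;
         ∈-upTo⁺; ∈-upTo⁻; ∈-allFin; ∈-map⁺; ∈-map⁻)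
import Data.List.Relation.Unary.All as All
import Data.List.Relation.Unary.All.Properties as All
open import Data.List.Relation.Unary.Any using (here)
open import Data.List.Relation.Unary.AllPairs as AllPairs using ([]; _∷_)
import Data.List.Relation.Unary.AllPairs.Properties as AllPairs
open import Data.List.Relation.Unary.Unique.Propositional using (Unique)
open import Data.List.Relation.Unary.Unique.Propositional.Properties
  using (concat⁺; map⁺; cartesianProductWith⁺; upTo⁺; allFin⁺)
open import Data.Nat.Base as ℕ using (ℕ; zero; suc; _+_; _∸_; _≤_; _<_; z≤n; s≤s)
open import Data.Nat.Properties as ℕ using (_≟_)
open import Data.Product.Base using (Σ; _×_; _,_; proj₁)
open import Data.Vec.Base using (Vec; []; _∷_; take; drop)
open import Function.Base using (_∘_)
open import Relation.Binary.PropositionalEquality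
  using (_≡_; _≗_; refl; sym; trans; cong; cong₂; module ≡-Reasoning)
open import Relation.Nullary.Decidable using (does)

-- The chain v₀ < ⋯ < v₍ₘ₋₁₎ is Fin m.
infixr 5 _⇒G_
_⇒G_ : ∀ {m} → Fin m → Fin m → Fin m
_⇒G_ {suc l} p q = if does (p ≤? q) then fromℕ l else q

infixr 5 _⇒_
data Bracketing : Set where
  var : Bracketing
  _⇒_ : Bracketing → Bracketing → Bracketing

leaves : Bracketing → ℕ
leaves var     = 1
leaves (l ⇒ r) = leaves l + leaves r

-- The i-th entry of the vector is the value of pᵢ, the i-th leaf from the left.
eval : ∀ {m} (t : Bracketing) → Vec (Fin m) (leaves t) → Fin m
eval var     (a ∷ []) = a
eval (l ⇒ r) v        = eval l (take (leaves l) v) ⇒G eval r (drop (leaves l) v)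

-- The first argument bounds the recursion; any bound ≥ n lists every
-- bracketing with n leaves.
bracketings≤ : ℕ → ℕ → List Bracketing
bracketings≤ zero    _             = []
bracketings≤ (suc d) zero          = []
bracketings≤ (suc d) (suc zero)    = [ var ]
bracketings≤ (suc d) (suc (suc n)) =
  concatMap (λ i → cartesianProductWith _⇒_ (bracketings≤ d (suc i)) (bracketings≤ d (suc n ∸ i)))
            (upTo (suc n))

bracketings : ℕ → List Bracketing
bracketings n = bracketings≤ n n

valuations : (m n : ℕ) → List (Vec (Fin m) n)
valuations m zero    = [ [] ]
valuations m (suc n) = cartesianProductWith _∷_ (allFin m) (valuations m n)

ValuedBracketing : ℕ → Set
ValuedBracketing m = Σ Bracketing λ t → Vec (Fin m) (leaves t)

pairs : (m n : ℕ) → List (ValuedBracketing m)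
pairs m n = concatMap (λ t → map (t ,_) (valuations m (leaves t))) (bracketings n)

-- g⟨ m ⟩ j n is gₙ⁽ʲ⁾.
g⟨_⟩ : (m j n : ℕ) → ℕ
g⟨ m ⟩ j n = length (filter (λ (t , v) → toℕ (eval t v) ≟ j) (pairs m n))

gTotal : (m n : ℕ) → ℕ
gTotal m n = ∑[ j < m ] g⟨ m ⟩ (toℕ j) n
  where open MonoidSum ℕ.+-0-commutativeMonoid using (sum-syntax)

module _ {A B : Set} (F : A → List B) (key : B → A)
         (key-F : ∀ x {y} → y ∈ F x → key y ≡ x) (F! : ∀ x → Unique (F x)) where

  concatMap-unique : ∀ {xs} → Unique xs → Unique (concatMap F xs)
  concatMap-unique {xs} xs! = concat⁺
    (All.map⁺ (All.universal F! xs))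
    (AllPairs.map⁺ (AllPairs.map
      (λ {x} {y} x≢y {v} (v∈x , v∈y) → x≢y (trans (sym (key-F x v∈x)) (key-F y v∈y))) xs!))

bracketings≤-sound : ∀ d n {t} → t ∈ bracketings≤ d n → leaves t ≡ n
bracketings≤-sound (suc d) (suc zero)    (here refl) = refl
bracketings≤-sound (suc d) (suc (suc n)) t∈
  with i , i∈ , t∈i ← find (∈-concatMap⁻ _ {xs = upTo (suc n)} t∈)
  with l , r , l∈ , r∈ , refl ← ∈-cartesianProductWith⁻ _⇒_
         (bracketings≤ d (suc i)) (bracketings≤ d (suc n ∸ i)) t∈i
  = trans (cong₂ _+_ (bracketings≤-sound d _ l∈) (bracketings≤-sound d _ r∈))
          (cong suc (ℕ.m+[n∸m]≡n (ℕ.<⇒≤ (∈-upTo⁻ i∈))))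

leaves>0 : ∀ t → 1 ≤ leaves t
leaves>0 var     = s≤s z≤n
leaves>0 (l ⇒ r) = ℕ.≤-trans (leaves>0 l) (ℕ.m≤m+n _ _)

bracketings≤-complete : ∀ d t n → leaves t ≡ n → n ≤ d → t ∈ bracketings≤ d n
bracketings≤-complete zero    var     _ refl ()
bracketings≤-complete (suc d) var     _ refl _   = here refl
bracketings≤-complete d       (l ⇒ r) n eq   n≤d
  with leaves l in eql | leaves r in eqr | leaves>0 l | leaves>0 r
bracketings≤-complete (suc d) (l ⇒ r) (suc zero) eq n≤d | suc a | suc b | _ | _
  with () ← trans (sym (ℕ.+-suc a b)) (ℕ.suc-injective eq)
bracketings≤-complete (suc d) (l ⇒ r) (suc (suc n)) eq (s≤s n≤d) | suc a | suc b | _ | _ =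
  ∈-concatMap⁺ _ (lose {x = a} (∈-upTo⁺ (ℕ.m+n≤o⇒m≤o (suc a) (ℕ.≤-reflexive sa+b≡sn)))
    (∈-cartesianProductWith⁺ _⇒_
      (bracketings≤-complete d l (suc a) eql
        (ℕ.≤-trans (ℕ.m+n≤o⇒m≤o (suc a) (ℕ.≤-reflexive sa+b≡sn)) n≤d))
      (bracketings≤-complete d r (suc n ∸ a) (trans eqr sb≡)
        (ℕ.≤-trans (ℕ.m∸n≤m (suc n) a) n≤d))))
  where
  a+sb≡sn : a + suc b ≡ suc n
  a+sb≡sn = ℕ.suc-injective eq
  sa+b≡sn : suc a + b ≡ suc n
  sa+b≡sn = trans (sym (ℕ.+-suc a b)) a+sb≡sn
  sb≡ : suc b ≡ suc n ∸ a
  sb≡ = trans (sym (ℕ.m+n∸m≡n a (suc b))) (cong (_∸ a) a+sb≡sn)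

bracketings≤-unique : ∀ d n → Unique (bracketings≤ d n)
bracketings≤-unique zero    n             = []
bracketings≤-unique (suc d) zero          = []
bracketings≤-unique (suc d) (suc zero)    = All.[] ∷ []
bracketings≤-unique (suc d) (suc (suc n)) = concatMap-unique F key key-F
  (λ i → cartesianProductWith⁺ _⇒_ (λ { refl → refl , refl })
           (bracketings≤-unique d (suc i)) (bracketings≤-unique d (suc n ∸ i)))
  (upTo⁺ (suc n))
  where
  F : ℕ → List Bracketing
  F i = cartesianProductWith _⇒_ (bracketings≤ d (suc i)) (bracketings≤ d (suc n ∸ i))
  key : Bracketing → ℕ
  key var     = 0
  key (l ⇒ r) = leaves l ∸ 1
  key-F : ∀ i {t} → t ∈ F i → key t ≡ i
  key-F i t∈
    with l , r , l∈ , r∈ , refl ← ∈-cartesianProductWith⁻ _⇒_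
           (bracketings≤ d (suc i)) (bracketings≤ d (suc n ∸ i)) t∈
    = cong (_∸ 1) (bracketings≤-sound d (suc i) l∈)

valuations-complete : ∀ {m n} (v : Vec (Fin m) n) → v ∈ valuations m n
valuations-complete []      = here refl
valuations-complete (a ∷ v) = ∈-cartesianProductWith⁺ _∷_ (∈-allFin a) (valuations-complete v)

valuations-unique : ∀ m n → Unique (valuations m n)
valuations-unique m zero    = All.[] ∷ []
valuations-unique m (suc n) =
  cartesianProductWith⁺ _∷_ (λ { refl → refl , refl }) (allFin⁺ m) (valuations-unique m n)

-- pairs m n lists, without repetition, exactly the bracketings with n
-- leaves together with their valuations.
pairs-sound : ∀ m n {t v} → (t , v) ∈ pairs m n → leaves t ≡ n
pairs-sound m n p∈
  with t , t∈ , p∈t ← find (∈-concatMap⁻ _ {xs = bracketings n} p∈)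
  with _ , _ , refl ← ∈-map⁻ (t ,_) p∈t
  = bracketings≤-sound n n t∈

pairs-complete : ∀ m n t v → leaves t ≡ n → (t , v) ∈ pairs m n
pairs-complete m n t v eq = ∈-concatMap⁺ _
  (lose (bracketings≤-complete n t n eq ℕ.≤-refl) (∈-map⁺ (t ,_) (valuations-complete v)))

pairs-unique : ∀ m n → Unique (pairs m n)
pairs-unique m n = concatMap-unique _ proj₁ key-F
  (λ t → map⁺ (λ { refl → refl }) (valuations-unique m (leaves t)))
  (bracketings≤-unique n n)
  where
  key-F : ∀ t {p} → p ∈ map (t ,_) (valuations m (leaves t)) → proj₁ p ≡ t
  key-F t p∈ with _ , _ , refl ← ∈-map⁻ (t ,_) p∈ = refl

open SemiringSum ℤ.+-*-semiring

-- Formal power series over ℤ as coefficient sequences; equality is _≗_.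
Series : Set
Series = ℕ → ℤ

infixl 6 _+ₛ_ _-ₛ_
infixl 7 _*ₛ_

_+ₛ_ _-ₛ_ _*ₛ_ : Series → Series → Series
(f +ₛ h) n = f n ℤ.+ h n
(f -ₛ h) n = f n ℤ.- h n
(f *ₛ h) n = ∑[ i ≤ n ] (f (toℕ i) ℤ.* h (n ∸ toℕ i))

1ₛ X : Series
1ₛ zero    = + 1
1ₛ (suc _) = + 0
X zero          = + 0
X (suc zero)    = + 1
X (suc (suc _)) = + 0

_^ₛ_ : Series → ℕ → Series
f ^ₛ zero  = 1ₛ
f ^ₛ suc k = f *ₛ (f ^ₛ k)

-- Zero constant term, the domain on which Φ makes sense.
record Series₀ : Set where
  constructor _,₀_
  field
    coeff  : Series
    coeff₀ : coeff 0 ≡ + 0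

open Series₀ public

-- (1 - u)⁻¹ = Σₖ uᵏ; only the terms with k ≤ n contribute to degree n.
[1-_]⁻¹ : Series₀ → Series
[1- u ]⁻¹ n = ∑[ k ≤ n ] (coeff u ^ₛ toℕ k) n

Φ : Series₀ → Series₀
Φ u = (coeff u +ₛ X *ₛ [1- u ]⁻¹) ,₀
      cong₂ ℤ._+_ (coeff₀ u) (trans (ℤ.+-identityʳ _) (ℤ.*-zeroˡ ([1- u ]⁻¹ 0)))

∑-zero : ∀ n (f : Fin n → ℤ) → (∀ i → f i ≡ + 0) → ∑[ i < n ] f i ≡ + 0
∑-zero n f f≡0 = trans (sum-cong-≗ f≡0) (sum-replicate-zero n)

∑-extend : ∀ {p q} → p ≤ q → (a : ℕ → ℤ) → (∀ k → p ≤ k → a k ≡ + 0) →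
           ∑[ k < p ] a (toℕ k) ≡ ∑[ k < q ] a (toℕ k)
∑-extend {q = q} z≤n a a≡0 = sym (∑-zero q _ (λ k → a≡0 (toℕ k) z≤n))
∑-extend (s≤s p≤q)   a a≡0 =
  cong (λ s → a 0 ℤ.+ s) (∑-extend p≤q (a ∘ suc) (λ k p≤k → a≡0 (suc k) (s≤s p≤k)))

∑-telescope : ∀ n (a : ℕ → ℤ) →
              ∑[ k < n ] (a (toℕ k) ℤ.- a (suc (toℕ k))) ≡ a 0 ℤ.- a n
∑-telescope zero    a = sym (ℤ.+-inverseʳ (a 0))
∑-telescope (suc n) a = begin
  (a 0 ℤ.- a 1) ℤ.+ ∑[ k < n ] (a (suc (toℕ k)) ℤ.- a (suc (suc (toℕ k))))
    ≡⟨ cong (λ s → (a 0 ℤ.- a 1) ℤ.+ s) (∑-telescope n (a ∘ suc)) ⟩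
  (a 0 ℤ.- a 1) ℤ.+ (a 1 ℤ.- a (suc n))
    ≡⟨ ℤ.+-minus-telescope (a 0) (a 1) (a (suc n)) ⟩
  a 0 ℤ.- a (suc n) ∎
  where open ≡-Reasoning

^ₛ-low : ∀ (u : Series₀) k n → n < k → (coeff u ^ₛ k) n ≡ + 0
^ₛ-low u (suc k) n (s≤s n≤k) = ∑-zero (suc n) _ term
  where
  term : ∀ i → coeff u (toℕ i) ℤ.* (coeff u ^ₛ k) (n ∸ toℕ i) ≡ + 0
  term zero = trans (cong (λ c → c ℤ.* (coeff u ^ₛ k) n) (coeff₀ u))
                    (ℤ.*-zeroˡ ((coeff u ^ₛ k) n))
  term (suc i) = trans
    (cong (λ c → coeff u (suc (toℕ i)) ℤ.* c)
          (^ₛ-low u k (n ∸ suc (toℕ i))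
            (ℕ.≤-trans (ℕ.∸-monoʳ-< (s≤s z≤n) (Fin.toℕ<n i)) n≤k)))
    (ℤ.*-zeroʳ (coeff u (suc (toℕ i))))

*ₛ-identityˡ : ∀ f → 1ₛ *ₛ f ≗ f
*ₛ-identityˡ f n = trans
  (cong₂ ℤ._+_ (ℤ.*-identityˡ (f n)) (∑-zero n _ (λ i → ℤ.*-zeroˡ (f (n ∸ suc (toℕ i))))))
  (ℤ.+-identityʳ (f n))

[1-u]*ₛ : ∀ f h → (1ₛ -ₛ f) *ₛ h ≗ h -ₛ (f *ₛ h)
[1-u]*ₛ f h n = begin
  ∑[ i ≤ n ] ((1ₛ (toℕ i) ℤ.- f (toℕ i)) ℤ.* h (n ∸ toℕ i))
    ≡⟨ sum-cong-≗ {suc n} (λ i → ℤ.*-distribʳ-+ (h (n ∸ toℕ i)) (1ₛ (toℕ i)) (ℤ.- f (toℕ i))) ⟩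
  ∑[ i ≤ n ] (1ₛ (toℕ i) ℤ.* h (n ∸ toℕ i) ℤ.+ (ℤ.- f (toℕ i)) ℤ.* h (n ∸ toℕ i))
    ≡⟨ ∑-distrib-+ {suc n} (λ i → 1ₛ (toℕ i) ℤ.* h (n ∸ toℕ i))
         (λ i → (ℤ.- f (toℕ i)) ℤ.* h (n ∸ toℕ i)) ⟩
  (1ₛ *ₛ h) n ℤ.+ ∑[ i ≤ n ] ((ℤ.- f (toℕ i)) ℤ.* h (n ∸ toℕ i))
    ≡⟨ cong₂ ℤ._+_ (*ₛ-identityˡ h n)
         (trans (sum-cong-≗ {suc n} neg)
                (sym (*-distribˡ-sum {suc n} ℤ.-1ℤ (λ i → f (toℕ i) ℤ.* h (n ∸ toℕ i))))) ⟩
  h n ℤ.+ ℤ.-1ℤ ℤ.* (f *ₛ h) n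
    ≡⟨ cong (λ c → h n ℤ.+ c) (ℤ.-1*i≡-i ((f *ₛ h) n)) ⟩
  h n ℤ.- (f *ₛ h) n ∎
  where
  open ≡-Reasoning
  neg : ∀ i → (ℤ.- f (toℕ i)) ℤ.* h (n ∸ toℕ i) ≡ ℤ.-1ℤ ℤ.* (f (toℕ i) ℤ.* h (n ∸ toℕ i))
  neg i = trans (sym (ℤ.neg-distribˡ-* (f (toℕ i)) (h (n ∸ toℕ i))))
                (sym (ℤ.-1*i≡-i (f (toℕ i) ℤ.* h (n ∸ toℕ i))))

[1-u]*[1-u]⁻¹ : ∀ u → (1ₛ -ₛ coeff u) *ₛ [1- u ]⁻¹ ≗ 1ₛ
[1-u]*[1-u]⁻¹ u n = begin
  ∑[ i ≤ n ] (c (toℕ i) ℤ.* ∑[ k ≤ n ∸ toℕ i ] p (toℕ k) (n ∸ toℕ i))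
    ≡⟨ sum-cong-≗ {suc n} (λ i → cong (λ s → c (toℕ i) ℤ.* s)
         (∑-extend (s≤s (ℕ.m∸n≤m n (toℕ i))) (λ k → p k (n ∸ toℕ i)) (λ k → ^ₛ-low u k _))) ⟩
  ∑[ i ≤ n ] (c (toℕ i) ℤ.* ∑[ k ≤ n ] p (toℕ k) (n ∸ toℕ i))
    ≡⟨ sum-cong-≗ {suc n} (λ i → *-distribˡ-sum {suc n} (c (toℕ i))
         (λ k → p (toℕ k) (n ∸ toℕ i))) ⟩
  ∑[ i ≤ n ] ∑[ k ≤ n ] (c (toℕ i) ℤ.* p (toℕ k) (n ∸ toℕ i))
    ≡⟨ ∑-comm {suc n} {suc n} (λ i k → c (toℕ i) ℤ.* p (toℕ k) (n ∸ toℕ i)) ⟩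
  ∑[ k ≤ n ] (c *ₛ p (toℕ k)) n
    ≡⟨ sum-cong-≗ {suc n} (λ k → [1-u]*ₛ (coeff u) (p (toℕ k)) n) ⟩
  ∑[ k ≤ n ] (p (toℕ k) n ℤ.- p (suc (toℕ k)) n)
    ≡⟨ ∑-telescope (suc n) (λ k → p k n) ⟩
  1ₛ n ℤ.- p (suc n) n
    ≡⟨ cong (λ s → 1ₛ n ℤ.- s) (^ₛ-low u (suc n) n ℕ.≤-refl) ⟩
  1ₛ n ℤ.+ + 0
    ≡⟨ ℤ.+-identityʳ (1ₛ n) ⟩
  1ₛ n ∎
  where
  open ≡-Reasoning
  c : Series
  c = 1ₛ -ₛ coeff u
  p : ℕ → Series
  p k = coeff u ^ₛ k

-- Σ_{n ≥ 1} aₙ xⁿ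
gf : (ℕ → ℕ) → Series₀
gf a = c ,₀ refl
  where
  c : Series
  c zero    = + 0
  c (suc n) = + a (suc n)

-- Indices j ≥ m are allowed and give the zero series.
G⟨_⟩ : (m j : ℕ) → Series₀
G⟨ m ⟩ j = gf (g⟨ m ⟩ j)

G : ℕ → Series₀
G m = gf (gTotal m)

-- Σ_{j = k}^{m - 1} Gⱼ
H : (m k : ℕ) → Series₀
H m k = (λ n → ∑[ i < m ∸ k ] coeff (G⟨ m ⟩ (k + toℕ i)) n) ,₀ sum-replicate-zero (m ∸ k)

{-# OPTIONS --safe #-}

-- For k < m - 1 a formula l ⇒ r takes the value v_k exactly when r does and
-- l takes a value above v_k. Hence G_k = x + H_{k+1} G_k. As H_{k+1} has zero
-- constant term, this equation determines G_k, and x / (1 - H_{k+1}) solves it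
-- too; finally H_k = H_{k+1} + G_k.

module Submission where

open import Defs
import Algebra.Properties.CommutativeMonoid.Sum as MonoidSum
import Algebra.Properties.Semiring.Sum as SemiringSum
open import Data.Bool.Base using (true; false; if_then_else_)
open import Data.Fin.Base using (Fin; zero; suc; toℕ; fromℕ)
import Data.Fin.Properties as Fin
open import Data.Integer.Base as ℤ using (ℤ; +_)
import Data.Integer.Properties as ℤ
open import Data.List.Base
  using (List; []; _∷_; _++_; length; map; filter; concat; concatMap; cartesianProductWith;
         upTo; applyUpTo; tabulate)
open import Data.List.Properties using (map-cong-local)
open import Data.List.Relation.Unary.All.Properties using (all-upTo)
import Data.List.Relation.Unary.All as All
open import Data.Nat.Base using (ℕ; zero; suc; _+_; _∸_; _≤_; _<_; _≡ᵇ_; z≤n; s≤s; s≤s⁻¹)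
open import Data.Nat.Induction using (<-rec)
import Data.Nat.Properties as ℕ
open import Data.Product.Base using (_×_; _,_)
open import Data.Vec.Base as Vec using (Vec; []; _∷_; take; drop)
open import Function.Base using (_∘_; id)
open import Function.Endo.Propositional Series₀ using (_^_)
open import Level using (0ℓ)
open import Relation.Binary.PropositionalEquality
  using (_≡_; _≢_; _≗_; refl; sym; trans; cong; cong₂; subst; module ≡-Reasoning)
open import Relation.Nullary.Decidable using (Dec; yes; no; does; dec-true; dec-false)
open import Relation.Nullary.Negation using (¬_)
open import Relation.Unary using (Pred; Decidable)

open SemiringSum ℤ.+-*-semiring
open ≡-Reasoning

private variable
  A B C : Set

-- Sums over lists

sumOver : List A → (A → ℤ) → ℤ
sumOver []       f = + 0
sumOver (x ∷ xs) f = f x ℤ.+ sumOver xs f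

sumOver-cong : ∀ (xs : List A) {f g} → f ≗ g → sumOver xs f ≡ sumOver xs g
sumOver-cong []       f≗g = refl
sumOver-cong (x ∷ xs) f≗g = cong₂ ℤ._+_ (f≗g x) (sumOver-cong xs f≗g)

sumOver-++ : ∀ (xs ys : List A) f → sumOver (xs ++ ys) f ≡ sumOver xs f ℤ.+ sumOver ys f
sumOver-++ []       ys f = sym (ℤ.+-identityˡ _)
sumOver-++ (x ∷ xs) ys f =
  trans (cong (λ s → f x ℤ.+ s) (sumOver-++ xs ys f)) (sym (ℤ.+-assoc (f x) _ _))

sumOver-map : ∀ (h : A → B) xs f → sumOver (map h xs) f ≡ sumOver xs (f ∘ h)
sumOver-map h []       f = refl
sumOver-map h (x ∷ xs) f = cong (λ s → f (h x) ℤ.+ s) (sumOver-map h xs f)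

sumOver-concatMap : ∀ (h : A → List B) xs f →
  sumOver (concatMap h xs) f ≡ sumOver xs (λ x → sumOver (h x) f)
sumOver-concatMap h []       f = refl
sumOver-concatMap h (x ∷ xs) f = trans (sumOver-++ (h x) _ f)
  (cong (λ s → sumOver (h x) f ℤ.+ s) (sumOver-concatMap h xs f))

sumOver-cartesianProductWith : ∀ (h : A → B → C) xs ys f →
  sumOver (cartesianProductWith h xs ys) f ≡ sumOver xs (λ x → sumOver ys (λ y → f (h x y)))
sumOver-cartesianProductWith h []       ys f = refl
sumOver-cartesianProductWith h (x ∷ xs) ys f = trans (sumOver-++ (map (h x) ys) _ f)
  (cong₂ ℤ._+_ (sumOver-map (h x) ys f) (sumOver-cartesianProductWith h xs ys f))

sumOver-*ˡ : ∀ (xs : List A) c f → sumOver xs (λ x → c ℤ.* f x) ≡ c ℤ.* sumOver xs f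
sumOver-*ˡ []       c f = sym (ℤ.*-zeroʳ c)
sumOver-*ˡ (x ∷ xs) c f = trans (cong (λ s → c ℤ.* f x ℤ.+ s) (sumOver-*ˡ xs c f))
  (sym (ℤ.*-distribˡ-+ c (f x) _))

sumOver-*ʳ : ∀ (xs : List A) c f → sumOver xs (λ x → f x ℤ.* c) ≡ sumOver xs f ℤ.* c
sumOver-*ʳ []       c f = sym (ℤ.*-zeroˡ c)
sumOver-*ʳ (x ∷ xs) c f = trans (cong (λ s → f x ℤ.* c ℤ.+ s) (sumOver-*ʳ xs c f))
  (sym (ℤ.*-distribʳ-+ c (f x) _))

sumOver-∑ : ∀ n (xs : List A) (f : Fin n → A → ℤ) →
  ∑[ i < n ] sumOver xs (f i) ≡ sumOver xs (λ x → ∑[ i < n ] f i x)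
sumOver-∑ n []       f = ∑-zero n _ (λ _ → refl)
sumOver-∑ n (x ∷ xs) f = trans (∑-distrib-+ {n} (λ i → f i x) (λ i → sumOver xs (f i)))
  (cong (λ s → ∑[ i < n ] f i x ℤ.+ s) (sumOver-∑ n xs f))

sumOver-tabulate : ∀ n (h : Fin n → A) f → sumOver (tabulate h) f ≡ ∑[ i < n ] f (h i)
sumOver-tabulate zero    h f = refl
sumOver-tabulate (suc n) h f = cong (λ s → f (h zero) ℤ.+ s) (sumOver-tabulate n (h ∘ suc) f)

sumOver-applyUpTo : ∀ n (h : ℕ → A) f → sumOver (applyUpTo h n) f ≡ ∑[ i < n ] f (h (toℕ i))
sumOver-applyUpTo zero    h f = refl
sumOver-applyUpTo (suc n) h f = cong (λ s → f (h 0) ℤ.+ s) (sumOver-applyUpTo n (h ∘ suc) f)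

-- Turns a count into a sum of indicators in the coefficient ring ℤ, where it can be factored and
-- reordered.
length-filter : ∀ {P : Pred A 0ℓ} (P? : Decidable P) xs →
  + length (filter P? xs) ≡ sumOver xs (λ x → if does (P? x) then + 1 else + 0)
length-filter P? []       = refl
length-filter P? (x ∷ xs) with does (P? x)
... | true  = cong (λ s → + 1 ℤ.+ s) (length-filter P? xs)
... | false = trans (length-filter P? xs) (sym (ℤ.+-identityˡ _))

-- Values of an implication

-- `does (x ℕ.≟ y)` reduces to `x ≡ᵇ y`, so this is the very indicator that `length-filter` yields
-- for `g⟨_⟩`, and it computes under common successors.
δ : ℕ → ℕ → ℤ
δ x y = if x ≡ᵇ y then + 1 else + 0

δ-≢ : ∀ {x y} → x ≢ y → δ x y ≡ + 0
δ-≢ {x} {y} x≢y rewrite dec-false (x ℕ.≟ y) x≢y = refl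

∑-δʳ : ∀ {n x} → x < n → ∑[ i < n ] δ x (toℕ i) ≡ + 1
∑-δʳ {suc n} {zero}  _         = cong (λ s → + 1 ℤ.+ s) (∑-zero n _ (λ _ → refl))
∑-δʳ {suc n} {suc x} (s≤s x<n) = trans (ℤ.+-identityˡ _) (∑-δʳ x<n)

∑-δˡ : ∀ {n x} → x < n → ∑[ i < n ] δ (toℕ i) x ≡ + 1
∑-δˡ {suc n} {zero}  _         = cong (λ s → + 1 ℤ.+ s) (∑-zero n _ (λ _ → refl))
∑-δˡ {suc n} {suc x} (s≤s x<n) = trans (ℤ.+-identityˡ _) (∑-δˡ x<n)

-- The indicator of `k < x < m`, spelled as a sum over the same index range as `H m (suc k)`:
-- summing it over valuations then leads to the coefficients of that series by exchanging finite
-- sums.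
above : (m k x : ℕ) → ℤ
above m k x = ∑[ i < m ∸ suc k ] δ x (suc k + toℕ i)

above-true : ∀ {m k x} → k < x → x < m → above m k x ≡ + 1
above-true {suc m} {zero}  {suc x} _         (s≤s x<m) = ∑-δʳ x<m
above-true {suc m} {suc k} {suc x} (s≤s k<x) (s≤s x<m) = above-true {m} k<x x<m

above-false : ∀ m {k x} → x ≤ k → above m k x ≡ + 0
above-false m {k} x≤k = ∑-zero (m ∸ suc k) _
  (λ i → δ-≢ (ℕ.<⇒≢ (s≤s (ℕ.≤-trans x≤k (ℕ.m≤m+n k (toℕ i))))))

⇒G-≤ : ∀ {m} {p q : Fin (suc m)} → toℕ p ≤ toℕ q → p ⇒G q ≡ fromℕ m
⇒G-≤ {p = p} {q} p≤q rewrite dec-true (p Fin.≤? q) p≤q = refl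

⇒G-≰ : ∀ {m} {p q : Fin (suc m)} → ¬ (toℕ p ≤ toℕ q) → p ⇒G q ≡ q
⇒G-≰ {p = p} {q} p≰q rewrite dec-false (p Fin.≤? q) p≰q = refl

-- If `p ≤ q`, the implication is the top element, which `suc k < m` separates from `k`; the product
-- vanishes too, since either `q` is not `k` or `p` is not above `k`. Otherwise the implication is
-- `q`, and `q = k` forces `p` above `k`.
⇒G-δ : ∀ {m k} → suc k < m → (p q : Fin m) →
  δ (toℕ (p ⇒G q)) k ≡ above m k (toℕ p) ℤ.* δ (toℕ q) k
⇒G-δ {suc m} {k} (s≤s k<m) p q with p Fin.≤? q | toℕ q ℕ.≟ k
... | no p≰q  | yes refl = begin
  δ (toℕ (p ⇒G q)) (toℕ q)  ≡⟨ cong (λ r → δ (toℕ r) (toℕ q)) (⇒G-≰ p≰q) ⟩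
  δ (toℕ q) (toℕ q)         ≡⟨ ℤ.*-identityˡ _ ⟨
  + 1 ℤ.* δ (toℕ q) (toℕ q) ≡⟨ cong (ℤ._* δ (toℕ q) (toℕ q))
                                 (above-true (ℕ.≰⇒> p≰q) (Fin.toℕ<n p)) ⟨
  above (suc m) (toℕ q) (toℕ p) ℤ.* δ (toℕ q) (toℕ q) ∎
... | no p≰q  | no q≢k   = begin
  δ (toℕ (p ⇒G q)) k        ≡⟨ cong (λ r → δ (toℕ r) k) (⇒G-≰ p≰q) ⟩
  δ (toℕ q) k               ≡⟨ δ-≢ q≢k ⟩
  + 0                       ≡⟨ ℤ.*-zeroʳ (above (suc m) k (toℕ p)) ⟨
  above (suc m) k (toℕ p) ℤ.* + 0
                            ≡⟨ cong (above (suc m) k (toℕ p) ℤ.*_) (δ-≢ q≢k) ⟨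
  above (suc m) k (toℕ p) ℤ.* δ (toℕ q) k ∎
... | yes p≤q | q≟k      = begin
  δ (toℕ (p ⇒G q)) k        ≡⟨ cong (λ r → δ (toℕ r) k) (⇒G-≤ p≤q) ⟩
  δ (toℕ (fromℕ m)) k       ≡⟨ cong (λ x → δ x k) (Fin.toℕ-fromℕ m) ⟩
  δ m k                     ≡⟨ δ-≢ (ℕ.>⇒≢ k<m) ⟩
  + 0                       ≡⟨ rhs≡0 q≟k ⟨
  above (suc m) k (toℕ p) ℤ.* δ (toℕ q) k ∎
  where
  rhs≡0 : Dec (toℕ q ≡ k) → above (suc m) k (toℕ p) ℤ.* δ (toℕ q) k ≡ + 0
  rhs≡0 (yes refl) = cong (ℤ._* δ (toℕ q) (toℕ q)) (above-false (suc m) p≤q)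
  rhs≡0 (no q≢k)   = trans (cong (above (suc m) k (toℕ p) ℤ.*_) (δ-≢ q≢k))
                           (ℤ.*-zeroʳ (above (suc m) k (toℕ p)))

-- Counting the valuations of one bracketing

-- The two blocks of variables are valued independently. Arbitrary `f` and `g` are allowed because
-- the induction on `a` fixes the first variable and passes to `f ∘ (x ∷_)`.
sumOver-valuations : ∀ m a b (f : Vec (Fin m) a → ℤ) (g : Vec (Fin m) b → ℤ) →
  sumOver (valuations m (a + b)) (λ v → f (take a v) ℤ.* g (drop a v))
    ≡ sumOver (valuations m a) f ℤ.* sumOver (valuations m b) g
sumOver-valuations m zero    b f g = trans (sumOver-*ˡ (valuations m b) (f []) g)
  (cong (ℤ._* sumOver (valuations m b) g) (sym (ℤ.+-identityʳ (f []))))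
sumOver-valuations m (suc a) b f g = begin
  sumOver (valuations m (suc a + b)) (λ v → f (take (suc a) v) ℤ.* g (drop (suc a) v))
    ≡⟨ sumOver-cartesianProductWith _∷_ xs (valuations m (a + b)) _ ⟩
  sumOver xs (λ x → sumOver (valuations m (a + b)) (λ v → f (x ∷ take a v) ℤ.* g (drop a v)))
    ≡⟨ sumOver-cong xs (λ x → sumOver-valuations m a b (f ∘ (x ∷_)) g) ⟩
  sumOver xs (λ x → sumOver (valuations m a) (f ∘ (x ∷_)) ℤ.* sumOver (valuations m b) g)
    ≡⟨ sumOver-*ʳ xs (sumOver (valuations m b) g) _ ⟩
  sumOver xs (λ x → sumOver (valuations m a) (f ∘ (x ∷_))) ℤ.* sumOver (valuations m b) g
    ≡⟨ cong (ℤ._* sumOver (valuations m b) g)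
         (sumOver-cartesianProductWith _∷_ xs (valuations m a) f) ⟨
  sumOver (valuations m (suc a)) f ℤ.* sumOver (valuations m b) g ∎
  where xs = tabulate id

#values : (m k : ℕ) → Bracketing → ℤ
#values m k t = sumOver (valuations m (leaves t)) (λ v → δ (toℕ (eval t v)) k)

#above : (m k : ℕ) → Bracketing → ℤ
#above m k t = ∑[ i < m ∸ suc k ] #values m (suc k + toℕ i) t

#values-var : ∀ {m k} → k < m → #values m k var ≡ + 1
#values-var {m} {k} k<m = begin
  #values m k var
    ≡⟨ sumOver-cartesianProductWith Vec._∷_ (tabulate id) (valuations m 0)
         (λ v → δ (toℕ (eval var v)) k) ⟩
  -- The `+ 0` ends the inner sum over the one-element list `valuations m 0`.
  sumOver (tabulate id) (λ (a : Fin m) → δ (toℕ a) k ℤ.+ + 0)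
    ≡⟨ sumOver-tabulate m id _ ⟩
  ∑[ a < m ] (δ (toℕ a) k ℤ.+ + 0)
    ≡⟨ sum-cong-≗ {m} (λ a → ℤ.+-identityʳ (δ (toℕ a) k)) ⟩
  ∑[ a < m ] δ (toℕ a) k
    ≡⟨ ∑-δˡ k<m ⟩
  + 1 ∎

-- The two subformulas have disjoint variables, so the pointwise product of `⇒G-δ` sums to a product
-- of counts.
#values-⇒ : ∀ {m k} → suc k < m → ∀ l r →
  #values m k (l ⇒ r) ≡ #above m k l ℤ.* #values m k r
#values-⇒ {m} {k} k<m l r = begin
  #values m k (l ⇒ r)
    ≡⟨ sumOver-cong (valuations m (leaves l + leaves r)) (λ v →
         ⇒G-δ k<m (eval l (take (leaves l) v)) (eval r (drop (leaves l) v))) ⟩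
  sumOver (valuations m (leaves l + leaves r))
    (λ v → above m k (toℕ (eval l (take (leaves l) v)))
           ℤ.* δ (toℕ (eval r (drop (leaves l) v))) k)
    ≡⟨ sumOver-valuations m (leaves l) (leaves r)
         (λ v → above m k (toℕ (eval l v))) (λ v → δ (toℕ (eval r v)) k) ⟩
  sumOver (valuations m (leaves l)) (λ v → above m k (toℕ (eval l v))) ℤ.* #values m k r
    ≡⟨ cong (ℤ._* #values m k r) (sumOver-∑ (m ∸ suc k) (valuations m (leaves l))
         (λ i v → δ (toℕ (eval l v)) (suc k + toℕ i))) ⟨
  #above m k l ℤ.* #values m k r ∎

-- Weighted generating functions of bracketings

-- Unfolding `bracketings (2 + n)` hands the bound `suc n` to both subtrees, whereas `weighted`
-- bounds each list by its own number of leaves; this reconciles the two.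
bracketings≤-stable : ∀ d e n → n ≤ d → n ≤ e → bracketings≤ d n ≡ bracketings≤ e n
bracketings≤-stable zero    zero    zero          _         _         = refl
bracketings≤-stable zero    (suc e) zero          _         _         = refl
bracketings≤-stable (suc d) zero    zero          _         _         = refl
bracketings≤-stable (suc d) (suc e) zero          _         _         = refl
bracketings≤-stable (suc d) (suc e) (suc zero)    _         _         = refl
bracketings≤-stable (suc d) (suc e) (suc (suc n)) (s≤s n<d) (s≤s n<e) =
  -- The local congruence is needed because `suc i` stays within the bounds only for members `i` of
  -- `upTo (suc n)`.
  cong concat (map-cong-local (All.map
    (λ {i} i≤n → cong₂ (cartesianProductWith _⇒_)
      (bracketings≤-stable d e (suc i) (ℕ.≤-trans i≤n n<d) (ℕ.≤-trans i≤n n<e))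
      (bracketings≤-stable d e (suc n ∸ i) (ℕ.≤-trans (ℕ.m∸n≤m (suc n) i) n<d)
                                           (ℕ.≤-trans (ℕ.m∸n≤m (suc n) i) n<e)))
    (all-upTo (suc n))))

weighted : (Bracketing → ℤ) → Series
weighted f n = sumOver (bracketings n) f

module _ {f a b : Bracketing → ℤ} (f-var : f var ≡ + 1)
         (f-⇒ : ∀ l r → f (l ⇒ r) ≡ a l ℤ.* b r) where

  weighted-⇒ : ∀ n → weighted f (2 + n)
    ≡ ∑[ i ≤ n ] (weighted a (suc (toℕ i)) ℤ.* weighted b (suc n ∸ toℕ i))
  weighted-⇒ n = begin
    weighted f (2 + n)
      ≡⟨ sumOver-concatMap pairs⇒ (upTo (suc n)) f ⟩
    sumOver (upTo (suc n)) (λ i → sumOver (pairs⇒ i) f)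
      ≡⟨ sumOver-applyUpTo (suc n) id (λ i → sumOver (pairs⇒ i) f) ⟩
    ∑[ i ≤ n ] sumOver (pairs⇒ (toℕ i)) f
      ≡⟨ sum-cong-≗ {suc n} (λ i → term (toℕ i) (Fin.toℕ<n i)) ⟩
    ∑[ i ≤ n ] (weighted a (suc (toℕ i)) ℤ.* weighted b (suc n ∸ toℕ i)) ∎
    where
    pairs⇒ : ℕ → List Bracketing
    pairs⇒ i = cartesianProductWith _⇒_ (bracketings≤ (suc n) (suc i))
                                         (bracketings≤ (suc n) (suc n ∸ i))
    term : ∀ i → i < suc n →
      sumOver (pairs⇒ i) f ≡ weighted a (suc i) ℤ.* weighted b (suc n ∸ i)
    term i i≤n = begin
      sumOver (pairs⇒ i) f
        ≡⟨ cong (λ ts → sumOver ts f) (cong₂ (cartesianProductWith _⇒_)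
             (bracketings≤-stable (suc n) (suc i) (suc i) i≤n ℕ.≤-refl)
             (bracketings≤-stable (suc n) (suc n ∸ i) (suc n ∸ i)
               (ℕ.m∸n≤m (suc n) i) ℕ.≤-refl)) ⟩
      sumOver (cartesianProductWith _⇒_ ls rs) f
        ≡⟨ sumOver-cartesianProductWith _⇒_ ls rs f ⟩
      sumOver ls (λ l → sumOver rs (λ r → f (l ⇒ r)))
        ≡⟨ sumOver-cong ls (λ l → trans (sumOver-cong rs (f-⇒ l)) (sumOver-*ˡ rs (a l) b)) ⟩
      sumOver ls (λ l → a l ℤ.* sumOver rs b)
        ≡⟨ sumOver-*ʳ ls (sumOver rs b) a ⟩
      weighted a (suc i) ℤ.* weighted b (suc n ∸ i) ∎
      where
      ls = bracketings (suc i)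
      rs = bracketings (suc n ∸ i)

  -- A bracketing is a leaf, contributing `X`, or a pair of bracketings; a weight multiplicative on
  -- pairs turns the second case into a Cauchy product.
  weighted-equation : weighted f ≗ X +ₛ weighted a *ₛ weighted b
  weighted-equation zero          = refl
  weighted-equation (suc zero)    = begin
    f var ℤ.+ + 0
      ≡⟨ cong (ℤ._+ + 0) f-var ⟩
    + 1
      ≡⟨ cong (λ s → + 1 ℤ.+ (+ 0 ℤ.+ (s ℤ.+ + 0))) (ℤ.*-zeroʳ (weighted a 1)) ⟨
    (X +ₛ weighted a *ₛ weighted b) 1 ∎
  weighted-equation (suc (suc n)) = begin
    weighted f (2 + n)
      ≡⟨ weighted-⇒ n ⟩
    ∑[ i < suc n ] c (toℕ i)
      -- The Cauchy product in degree `2 + n` has two more terms than the sum over splittings, one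
      -- at each end. The last contains `weighted b 0` and is added here; the first contains
      -- `weighted a 0` and is absorbed in the next step together with the zero coefficient of `X`.
      ≡⟨ ∑-extend (ℕ.n≤1+n (suc n)) c (λ i n<i →
           trans (cong (λ j → weighted a (suc i) ℤ.* weighted b j) (ℕ.m≤n⇒m∸n≡0 n<i))
                 (ℤ.*-zeroʳ (weighted a (suc i)))) ⟩
    ∑[ i < 2 + n ] c (toℕ i)
      ≡⟨ trans (ℤ.+-identityˡ _) (ℤ.+-identityˡ _) ⟨
    (X +ₛ weighted a *ₛ weighted b) (2 + n) ∎
    where
    c : ℕ → ℤ
    c i = weighted a (suc i) ℤ.* weighted b (suc n ∸ i)

G-weighted : ∀ m k → coeff (G⟨ m ⟩ k) ≗ weighted (#values m k)
G-weighted m k zero    = refl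
G-weighted m k (suc n) = begin
  + g⟨ m ⟩ k (suc n)
    ≡⟨ length-filter (λ (t , v) → toℕ (eval t v) ℕ.≟ k) (pairs m (suc n)) ⟩
  sumOver (pairs m (suc n)) w
    ≡⟨ sumOver-concatMap valued (bracketings (suc n)) w ⟩
  sumOver (bracketings (suc n)) (λ t → sumOver (valued t) w)
    ≡⟨ sumOver-cong (bracketings (suc n)) (λ t → sumOver-map (t ,_) (valuations m (leaves t)) w) ⟩
  weighted (#values m k) (suc n) ∎
  where
  w : ValuedBracketing m → ℤ
  w (t , v) = δ (toℕ (eval t v)) k
  valued : Bracketing → List (ValuedBracketing m)
  valued t = map (t ,_) (valuations m (leaves t))

H-weighted : ∀ m k → coeff (H m (suc k)) ≗ weighted (#above m k)
H-weighted m k n = trans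
  (sum-cong-≗ {m ∸ suc k} (λ i → G-weighted m (suc k + toℕ i) n))
  (sumOver-∑ (m ∸ suc k) (bracketings n) (λ i → #values m (suc k + toℕ i)))

-- Linear equations in power series

*ₛ-cong : ∀ {f f′ h h′} → f ≗ f′ → h ≗ h′ → f *ₛ h ≗ f′ *ₛ h′
*ₛ-cong f≗ h≗ n = sum-cong-≗ {suc n} (λ i → cong₂ ℤ._*_ (f≗ (toℕ i)) (h≗ (n ∸ toℕ i)))

^ₛ-cong : ∀ {f f′} → f ≗ f′ → ∀ k → f ^ₛ k ≗ f′ ^ₛ k
^ₛ-cong f≗ zero    n = refl
^ₛ-cong f≗ (suc k)   = *ₛ-cong f≗ (^ₛ-cong f≗ k)

-- Series are compared only coefficientwise, so replacing the argument of an iterated `Φ` requires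
-- this congruence.
Φ-cong : ∀ {u v} → coeff u ≗ coeff v → coeff (Φ u) ≗ coeff (Φ v)
Φ-cong u≗v n = cong₂ ℤ._+_ (u≗v n) (*ₛ-cong {X} (λ _ → refl)
  (λ j → sum-cong-≗ {suc j} (λ k → ^ₛ-cong u≗v (toℕ k) j)) n)

X*ₛ-suc : ∀ f n → (X *ₛ f) (suc n) ≡ f n
X*ₛ-suc f n = begin
  + 0 ℤ.* f (suc n) ℤ.+ (+ 1 ℤ.* f n ℤ.+ ∑[ i < n ] (+ 0 ℤ.* f (n ∸ suc (toℕ i))))
    ≡⟨ ℤ.+-identityˡ _ ⟩
  + 1 ℤ.* f n ℤ.+ ∑[ i < n ] (+ 0 ℤ.* f (n ∸ suc (toℕ i)))
    ≡⟨ cong₂ ℤ._+_ (ℤ.*-identityˡ (f n)) (∑-zero n _ (λ _ → refl)) ⟩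
  f n ℤ.+ + 0
    ≡⟨ ℤ.+-identityʳ (f n) ⟩
  f n ∎

[1-u]⁻¹-equation : ∀ u → [1- u ]⁻¹ ≗ 1ₛ +ₛ coeff u *ₛ [1- u ]⁻¹
[1-u]⁻¹-equation u n = begin
  i                    ≡⟨ ℤ.+-identityʳ i ⟨
  i ℤ.+ + 0            ≡⟨ cong (λ s → i ℤ.+ s) (ℤ.+-inverseˡ p) ⟨
  i ℤ.+ (ℤ.- p ℤ.+ p)  ≡⟨ ℤ.+-assoc i (ℤ.- p) p ⟨
  (i ℤ.- p) ℤ.+ p      ≡⟨ cong (ℤ._+ p) (trans (sym ([1-u]*ₛ (coeff u) [1- u ]⁻¹ n))
                                             ([1-u]*[1-u]⁻¹ u n)) ⟩
  1ₛ n ℤ.+ p           ∎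
  where
  i = [1- u ]⁻¹ n
  p = (coeff u *ₛ [1- u ]⁻¹) n

-- This is `X` times `[1-u]⁻¹-equation`, carried out on coefficients, where multiplication by `X` is
-- a shift by one degree.
X/[1-u]-equation : ∀ u → X *ₛ [1- u ]⁻¹ ≗ X +ₛ coeff u *ₛ (X *ₛ [1- u ]⁻¹)
X/[1-u]-equation u zero    = sym (trans (ℤ.+-identityˡ _) (trans (ℤ.+-identityʳ _)
  (ℤ.*-zeroʳ (coeff u 0))))
X/[1-u]-equation u (suc n) = begin
  (X *ₛ inv) (suc n)
    ≡⟨ X*ₛ-suc inv n ⟩
  inv n
    ≡⟨ [1-u]⁻¹-equation u n ⟩
  1ₛ n ℤ.+ ∑[ i < suc n ] (coeff u (toℕ i) ℤ.* inv (n ∸ toℕ i))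
    ≡⟨ cong₂ ℤ._+_ (1≡X n) (sum-cong-≗ {suc n} (λ i →
         cong (coeff u (toℕ i) ℤ.*_) (shift (toℕ i) (s≤s⁻¹ (Fin.toℕ<n i))))) ⟩
  X (suc n) ℤ.+ ∑[ i < suc n ] c (toℕ i)
    -- The added term at `i = suc n` has the factor `(X *ₛ inv) 0`, which is zero.
    ≡⟨ cong (λ s → X (suc n) ℤ.+ s) (∑-extend (ℕ.n≤1+n (suc n)) c (λ i n<i →
         trans (cong (λ j → coeff u i ℤ.* (X *ₛ inv) j) (ℕ.m≤n⇒m∸n≡0 n<i))
               (ℤ.*-zeroʳ (coeff u i)))) ⟩
  (X +ₛ coeff u *ₛ (X *ₛ inv)) (suc n) ∎
  where
  inv = [1- u ]⁻¹
  c : ℕ → ℤ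
  c i = coeff u i ℤ.* (X *ₛ inv) (suc n ∸ i)
  1≡X : ∀ n → 1ₛ n ≡ X (suc n)
  1≡X zero    = refl
  1≡X (suc n) = refl
  shift : ∀ i → i ≤ n → inv (n ∸ i) ≡ (X *ₛ inv) (suc n ∸ i)
  shift i i≤n = trans (sym (X*ₛ-suc inv (n ∸ i)))
    (cong (X *ₛ inv) (sym (ℕ.+-∸-assoc 1 i≤n)))

-- Since `u` has zero constant term, the coefficient of degree `n` of `u f` depends only on
-- coefficients of `f` below `n`; strong induction on the degree does the rest.
linear-unique : ∀ u {w f h} →
  f ≗ w +ₛ coeff u *ₛ f → h ≗ w +ₛ coeff u *ₛ h → f ≗ h
linear-unique u {w} {f} {h} f-eq h-eq = <-rec (λ n → f n ≡ h n) step
  where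
  step : ∀ n → (∀ {j} → j < n → f j ≡ h j) → f n ≡ h n
  step n rec = begin
    f n                         ≡⟨ f-eq n ⟩
    w n ℤ.+ (coeff u *ₛ f) n    ≡⟨ cong (λ s → w n ℤ.+ s) (sum-cong-≗ {suc n} term) ⟩
    w n ℤ.+ (coeff u *ₛ h) n    ≡⟨ h-eq n ⟨
    h n                         ∎
    where
    term : (i : Fin (suc n)) →
      coeff u (toℕ i) ℤ.* f (n ∸ toℕ i) ≡ coeff u (toℕ i) ℤ.* h (n ∸ toℕ i)
    term zero    = trans (cong (ℤ._* f n) (coeff₀ u)) (cong (ℤ._* h n) (sym (coeff₀ u)))
    term (suc i) = cong (coeff u (suc (toℕ i)) ℤ.*_)
      (rec (ℕ.∸-monoʳ-< (s≤s z≤n) (Fin.toℕ<n i)))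

-- The recursion for the tail sums and its iteration

G≗X/[1-H] : ∀ {m k} → suc k < m → coeff (G⟨ m ⟩ k) ≗ X *ₛ [1- H m (suc k) ]⁻¹
G≗X/[1-H] {m} {k} k<m = linear-unique u {X} G-equation (X/[1-u]-equation u)
  where
  u = H m (suc k)
  G-equation : coeff (G⟨ m ⟩ k) ≗ X +ₛ coeff u *ₛ coeff (G⟨ m ⟩ k)
  G-equation n = begin
    coeff (G⟨ m ⟩ k) n
      ≡⟨ G-weighted m k n ⟩
    weighted (#values m k) n
      ≡⟨ weighted-equation (#values-var (ℕ.<⇒≤ k<m)) (#values-⇒ k<m) n ⟩
    (X +ₛ weighted (#above m k) *ₛ weighted (#values m k)) n
      ≡⟨ cong (λ s → X n ℤ.+ s) (*ₛ-cong (H-weighted m k) (G-weighted m k) n) ⟨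
    (X +ₛ coeff u *ₛ coeff (G⟨ m ⟩ k)) n ∎

-- Splits off the lowest summand. Unlike `H≗Φ` it also covers `k = m - 1`, which `H-last` uses.
H-suc : ∀ {m k} → k < m → coeff (H m k) ≗ coeff (H m (suc k)) +ₛ coeff (G⟨ m ⟩ k)
H-suc {suc m} {k} (s≤s k≤m) n = begin
  ∑[ i < suc m ∸ k ] c (k + toℕ i)
    ≡⟨ cong (λ l → ∑[ i < l ] c (k + toℕ i)) (ℕ.+-∸-assoc 1 k≤m) ⟩
  c (k + 0) ℤ.+ ∑[ i < m ∸ k ] c (k + suc (toℕ i))
    ≡⟨ cong₂ ℤ._+_ (cong c (ℕ.+-identityʳ k))
         (sum-cong-≗ {m ∸ k} (λ i → cong c (ℕ.+-suc k (toℕ i)))) ⟩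
  c k ℤ.+ ∑[ i < m ∸ k ] c (suc k + toℕ i)
    ≡⟨ ℤ.+-comm (c k) _ ⟩
  ∑[ i < m ∸ k ] c (suc k + toℕ i) ℤ.+ c k ∎
  where
  c : ℕ → ℤ
  c j = coeff (G⟨ suc m ⟩ j) n

H≗Φ : ∀ {m k} → suc k < m → coeff (H m k) ≗ coeff (Φ (H m (suc k)))
H≗Φ {m} {k} k<m n = trans (H-suc (ℕ.<⇒≤ k<m) n)
  (cong (λ s → coeff (H m (suc k)) n ℤ.+ s) (G≗X/[1-H] k<m n))

-- The starting index `k` varies because `Φ ^ suc j` unfolds at its outermost `Φ`: that one accounts
-- for the step from `k` to `suc k`, and the induction hypothesis at `suc k` acts inside it.
H≗Φ^ : ∀ {m} j k → j + k < m → coeff (H m k) ≗ coeff ((Φ ^ j) (H m (j + k)))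
H≗Φ^     zero      k _   n = refl
H≗Φ^ {m} (suc j) k k<m n = begin
  coeff (H m k) n
    ≡⟨ H≗Φ (ℕ.≤-<-trans (s≤s (ℕ.m≤n+m k j)) k<m) n ⟩
  coeff (Φ (H m (suc k))) n
    ≡⟨ Φ-cong {H m (suc k)} {(Φ ^ j) (H m (j + suc k))}
         (H≗Φ^ j (suc k) (subst (_< m) (sym (ℕ.+-suc j k)) k<m)) n ⟩
  coeff (Φ ((Φ ^ j) (H m (j + suc k)))) n
    ≡⟨ cong (λ i → coeff (Φ ((Φ ^ j) (H m i))) n) (ℕ.+-suc j k) ⟩
  coeff ((Φ ^ suc j) (H m (suc j + k))) n ∎

open MonoidSum ℕ.+-0-commutativeMonoid using () renaming (sum to sumℕ)

-- Bridges `gTotal`, which adds in ℕ, and `H`, which adds in ℤ.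
+-sum : ∀ n (f : Fin n → ℕ) → + sumℕ f ≡ sum (λ i → + f i)
+-sum zero    f = refl
+-sum (suc n) f = trans (ℤ.pos-+ (f zero) _) (cong (λ s → + f zero ℤ.+ s) (+-sum n (f ∘ suc)))

G≗H₀ : ∀ m → coeff (G m) ≗ coeff (H m 0)
G≗H₀ m zero    = sym (coeff₀ (H m 0))
G≗H₀ m (suc n) = +-sum m (λ j → g⟨ m ⟩ (toℕ j) (suc n))

H-last : ∀ m → coeff (H (suc m) m) ≗ coeff (G⟨ suc m ⟩ m)
H-last m n = trans (H-suc {suc m} ℕ.≤-refl n) (trans
  -- What remains beyond the top index is a sum of length `m ∸ m`, hence empty.
  (cong (λ l → ∑[ i < l ] coeff (G⟨ suc m ⟩ (suc m + toℕ i)) n ℤ.+ coeff (G⟨ suc m ⟩ m) n)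
        (ℕ.n∸n≡0 m))
  (ℤ.+-identityˡ _))

proposition5 : (m : ℕ) → 2 ≤ m →
    ((k : ℕ) → k ≤ m ∸ 2 → coeff (H m k) ≗ coeff (Φ (H m (suc k))))
    × (let U = H m (m ∸ 1) in
       (coeff U ≗ coeff (G⟨ m ⟩ (m ∸ 1)))
       × (coeff (G m) ≗ coeff ((Φ ^ (m ∸ 1)) U)))
proposition5 (suc (suc m)) (s≤s (s≤s _)) =
    (λ k k≤m → H≗Φ (s≤s (s≤s k≤m)))
  , H-last (suc m)
  , λ n → trans (G≗H₀ (2 + m) n) (trans
      -- Starting from `k = 0`, the `suc m` steps end at index `suc m + 0`, which is that of `U`
      -- once the `+ 0` is removed.
      (H≗Φ^ (suc m) 0 (s≤s (ℕ.≤-reflexive (ℕ.+-identityʳ (suc m)))) n)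
      (cong (λ i → coeff ((Φ ^ suc m) (H (2 + m) i)) n) (ℕ.+-identityʳ (suc m))))
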